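{- Let $\mathbb{F}$ be a field, let $n\ge 1$ and $r\ge 0$ be integers, and let $f\in\mathbb{F}[x_1,x_2,\dots,x_n]$ be a polynomial of (total) degree $d$. Suppose that $f(x)=0$ for every vertex $x\in\{0,1\}^n\subset\mathbb{F}^n$ of the unit cube of weight greater than $r$, and that $f(x)\neq 0$ for every vertex $x\in\{0,1\}^n$ of weight at most $r$. Then $d\ge n-r$.
   Context: The unit cube is the set $\{0,1\}^n$ regarded as a subset of the vector space $\mathbb{F}^n$, and its elements are called vertices. The weight of a vector in $\mathbb{F}^n$ is the number of its nonzero coordinates. -}

module Defs where

open import Algebra.Bundles using (CommutativeRing; Semiring)
open import Data.Fin.Base using (Fin)
open import Data.Fin.Subset using (Subset; ∣_∣) renaming (_∈_ to _∈ₛ_)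
open import Data.List.Base using (List; length) renaming (lookup to lookupₗ)
open import Data.List.Membership.Propositional using (_∉_)
open import Data.List.Relation.Unary.Unique.Propositional using (Unique)
open import Data.Nat.Base using (ℕ; _≤_)
open import Data.Product.Base using (_×_; ∃-syntax; Σ-syntax)
open import Data.Sum.Base using (_⊎_)
open import Data.Vec.Base using (Vec; lookup) renaming (sum to sumᵥ)
open import Data.Vec.Functional using (Vector)
open import Function.Bundles using (_⇔_)
open import Level using (_⊔_) renaming (suc to lsuc)
open import Relation.Binary.PropositionalEquality using (_≡_)

import Algebra.Definitions
import Algebra.Definitions.RawSemiring

-- Nonzero means ≉ 0#, the denial of equality; neither an apartness relation
-- (as in HeytingField) nor decidability of ≈ is assumed.
record Field c ℓ : Set (lsuc (c ⊔ ℓ)) where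
  field
    commutativeRing : CommutativeRing c ℓ

  open CommutativeRing commutativeRing public
  open Algebra.Definitions _≈_ using (Invertible)

  field
    1≉0           : 1# ≉ 0#
    ≉0⇒invertible : ∀ {x} → x ≉ 0# → Invertible 1# _*_ x

Monomial : ℕ → Set
Monomial n = Vec ℕ n

module _ {c ℓ} (F : Field c ℓ) where
  open Field F using (Carrier; _≈_; _≉_; 0#; 1#; _*_; semiring)
  open Algebra.Definitions.RawSemiring (Semiring.rawSemiring semiring)
    using (sum; product; _^_)

  -- A finitely supported function from exponent vectors to coefficients.
  -- The list bounds the support: it may also contain monomials whose
  -- coefficient is zero, but none of them twice.
  record Polynomial (n : ℕ) : Set (c ⊔ ℓ) where
    field
      coeff         : Monomial n → Carrier
      support       : List (Monomial n)
      unique        : Unique support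
      coeff-outside : ∀ m → m ∉ support → coeff m ≈ 0#

  module _ {n : ℕ} where

    evalMonomial : Monomial n → Vector Carrier n → Carrier
    evalMonomial m x = product λ i → x i ^ lookup m i

    eval : Polynomial n → Vector Carrier n → Carrier
    eval f x = sum {length support} λ j →
      let m = lookupₗ support j in coeff m * evalMonomial m x
      where open Polynomial f

    -- The zero polynomial has no degree in this sense.
    HasTotalDegree : Polynomial n → ℕ → Set ℓ
    HasTotalDegree f d =
        (∃[ m ] (sumᵥ m ≡ d × coeff m ≉ 0#))
      × (∀ m → coeff m ≉ 0# → sumᵥ m ≤ d)
      where open Polynomial f

    IsVertex : Vector Carrier n → Set ℓ
    IsVertex x = ∀ i → x i ≈ 0# ⊎ x i ≈ 1#

    -- A relation rather than a function because ≈ need not be decidable;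
    -- every vertex nevertheless has exactly one weight.
    HasWeight : Vector Carrier n → ℕ → Set ℓ
    HasWeight x w =
      Σ[ S ∈ Subset n ] ((∀ (i : Fin n) → i ∈ₛ S ⇔ x i ≉ 0#) × ∣ S ∣ ≡ w)

{-# OPTIONS --safe #-}
-- For a vertex T, the alternating sum of f over the vertices above T kills
-- every monomial of degree less than n − |T|, because such a monomial does not
-- involve some coordinate outside T.  If d < n − r, the alternating sum of f
-- above any T with |T| ≤ r is therefore zero; once f vanishes at all heavier
-- vertices it reduces to f(T).  Downward induction on |T| gives f = 0 on the
-- whole cube, against f(0) ≠ 0.
module Submission where

open import Defs
open import Data.Nat.Base using (ℕ; _≤_; _<_; _≥_; _∸_)
open import Data.Vec.Functional using (Vector)

open import Algebra.Bundles using (Semiring)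
open import Data.Bool.Base using (true; false; if_then_else_)
open import Data.Fin.Base using (Fin; zero; suc)
open import Data.Fin.Properties using (sequence)
open import Data.Fin.Subset using (Subset; ∣_∣; inside; outside; ⊥) renaming (_∈_ to _∈ₛ_)
open import Data.Fin.Subset.Properties using (∣p∣≤n; ∣⊥∣≡0)
open import Data.List.Base using () renaming (lookup to lookupₗ)
open import Data.Nat.Base as ℕ using (zero; suc; z≤n; s≤s; s≤s⁻¹)
import Data.Nat.Properties as ℕ
open import Data.Product.Base using (_,_)
open import Data.Sum.Base using (_⊎_; inj₁; inj₂)
open import Data.Vec.Base using ([]; _∷_; lookup) renaming (sum to sumᵥ)
open import Data.Vec.Properties using ([]=⇒lookup; lookup⇒[]=)
open import Effect.Monad using (RawMonad)
open import Function.Base using (_∘_)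
open import Function.Bundles using (mk⇔)
open import Relation.Binary.PropositionalEquality as ≡ using (refl)
open import Relation.Nullary using (¬_; yes; no; contradiction)
open import Relation.Nullary.Negation using (¬¬-Monad)

import Algebra.Definitions.RawSemiring
import Algebra.Properties.CommutativeSemigroup
import Algebra.Properties.Ring
import Relation.Binary.Reasoning.Setoid

module _ {c ℓ} (F : Field c ℓ) where
  open Field F hiding (refl; zero)
  open Algebra.Definitions.RawSemiring (Semiring.rawSemiring semiring)
    using (sum; _^_)
  open Algebra.Properties.Ring ring using (-‿+-comm; x[y-z]≈xy-xz; -0#≈0#)
  open Algebra.Properties.CommutativeSemigroup +-commutativeSemigroup
    using (interchange)
  open Relation.Binary.Reasoning.Setoid setoid

  -- Σ (-1)^(|U| − |T|) g U, over all U ⊇ T.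
  altSum : ∀ {n} → Subset n → (Subset n → Carrier) → Carrier
  altSum []            g = g []
  altSum (inside  ∷ T) g = altSum T (g ∘ (inside ∷_))
  altSum (outside ∷ T) g =
    altSum T (g ∘ (outside ∷_)) - altSum T (g ∘ (inside ∷_))

  x≈y∧z≈0⇒x-z≈y : ∀ {x y z} → x ≈ y → z ≈ 0# → x - z ≈ y
  x≈y∧z≈0⇒x-z≈y {x} {y} {z} x≈y z≈0 = begin
    x - z   ≈⟨ +-cong x≈y (trans (-‿cong z≈0) -0#≈0#) ⟩
    y + 0#  ≈⟨ +-identityʳ y ⟩
    y       ∎

  altSum-+ : ∀ {n} (T : Subset n) (g h : Subset n → Carrier) →
             altSum T (λ U → g U + h U) ≈ altSum T g + altSum T h
  altSum-+ []            g h = Field.refl F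
  altSum-+ (inside  ∷ T) g h = altSum-+ T _ _
  altSum-+ (outside ∷ T) g h = begin
    altSum T (λ U → g₀ U + h₀ U) - altSum T (λ U → g₁ U + h₁ U)
      ≈⟨ +-cong (altSum-+ T g₀ h₀) (-‿cong (altSum-+ T g₁ h₁)) ⟩
    (altSum T g₀ + altSum T h₀) - (altSum T g₁ + altSum T h₁)
      ≈⟨ +-congˡ (-‿+-comm _ _) ⟨
    (altSum T g₀ + altSum T h₀) + (- altSum T g₁ - altSum T h₁)
      ≈⟨ interchange _ _ _ _ ⟩
    (altSum T g₀ - altSum T g₁) + (altSum T h₀ - altSum T h₁) ∎
    where
    g₀ = g ∘ (outside ∷_)
    g₁ = g ∘ (inside ∷_)
    h₀ = h ∘ (outside ∷_)
    h₁ = h ∘ (inside ∷_)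

  altSum-* : ∀ {n} (T : Subset n) a (g : Subset n → Carrier) →
             altSum T (λ U → a * g U) ≈ a * altSum T g
  altSum-* []            a g = Field.refl F
  altSum-* (inside  ∷ T) a g = altSum-* T a _
  altSum-* (outside ∷ T) a g =
    trans (+-cong (altSum-* T a _) (-‿cong (altSum-* T a _)))
          (sym (x[y-z]≈xy-xz a _ _))

  altSum-*-zero : ∀ {n} (T : Subset n) a (g : Subset n → Carrier) →
                  altSum T g ≈ 0# → altSum T (λ U → a * g U) ≈ 0#
  altSum-*-zero T a g g≈0 =
    trans (altSum-* T a g) (trans (*-congˡ g≈0) (zeroʳ a))

  -- Every set above `T` other than `T` itself is heavier, so only the term at `T`, which carries
  -- the sign plus, survives.
  altSum-lowest : ∀ {n} (T : Subset n) (g : Subset n → Carrier) →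
                  (∀ U → ∣ T ∣ < ∣ U ∣ → g U ≈ 0#) → altSum T g ≈ g T
  altSum-lowest []            g g≈0 = Field.refl F
  altSum-lowest (inside  ∷ T) g g≈0 =
    altSum-lowest T _ λ U T<U → g≈0 (inside ∷ U) (s≤s T<U)
  altSum-lowest (outside ∷ T) g g≈0 = x≈y∧z≈0⇒x-z≈y
    (altSum-lowest T _ λ U T<U → g≈0 (outside ∷ U) T<U)
    -- The half with the coordinate inside reduces to its own lowest term, at `inside ∷ T`, which is
    -- already one heavier than `outside ∷ T`.
    (trans (altSum-lowest T _ λ U T<U → g≈0 (inside ∷ U) (ℕ.m<n⇒m<1+n T<U))
           (g≈0 (inside ∷ T) ℕ.≤-refl))

  altSum-sum : ∀ {n} (T : Subset n) {k} (h : Fin k → Subset n → Carrier) →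
               (∀ j → altSum T (h j) ≈ 0#) →
               altSum T (λ U → sum (λ j → h j U)) ≈ 0#
  -- The empty sum is constantly `0#`, so its lowest term is `0#` too.
  altSum-sum T {zero}  h h≈0 = altSum-lowest T _ λ _ _ → Field.refl F
  altSum-sum T {suc k} h h≈0 = begin
    altSum T (λ U → h zero U + sum (λ j → h (suc j) U))
      ≈⟨ altSum-+ T _ _ ⟩
    altSum T (h zero) + altSum T (λ U → sum (λ j → h (suc j) U))
      ≈⟨ +-cong (h≈0 zero) (altSum-sum T (h ∘ suc) (h≈0 ∘ suc)) ⟩
    0# + 0#
      ≈⟨ +-identityˡ 0# ⟩
    0# ∎

  indicator : ∀ {n} → Subset n → Vector Carrier n
  indicator U i = if lookup U i then 1# else 0#

  indicator-isVertex : ∀ {n} (U : Subset n) → IsVertex F (indicator U)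
  indicator-isVertex U i with lookup U i
  ... | true  = inj₂ (Field.refl F)
  ... | false = inj₁ (Field.refl F)

  indicator-hasWeight : ∀ {n} (U : Subset n) → HasWeight F (indicator U) ∣ U ∣
  indicator-hasWeight U = U , (λ i → mk⇔ (to i) (from i)) , refl
    where
    to : ∀ i → i ∈ₛ U → indicator U i ≉ 0#
    to i i∈U rewrite []=⇒lookup i∈U = 1≉0

    from : ∀ i → indicator U i ≉ 0# → i ∈ₛ U
    from i x≉0 with lookup U i in eq
    ... | true  = lookup⇒[]= i U eq
    ... | false = contradiction (Field.refl F) x≉0

  -- There are more coordinates outside `T` than the degree of `m`, so one of them has exponent
  -- zero. The induction searches for it: a coordinate in `T` lowers both sides of the bound by one,
  -- and a positive exponent outside `T` does so at least on the left.
  altSum-evalMonomial : ∀ {n} (T : Subset n) (m : Monomial n) →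
                        sumᵥ m ℕ.+ ∣ T ∣ < n →
                        altSum T (evalMonomial F m ∘ indicator) ≈ 0#
  altSum-evalMonomial {suc n} (inside ∷ T) (a ∷ m) m+T<n =
    altSum-*-zero T (1# ^ a) _ (altSum-evalMonomial T m
      (ℕ.≤-<-trans (ℕ.+-monoˡ-≤ ∣ T ∣ (ℕ.m≤n+m (sumᵥ m) a))
        (s≤s⁻¹ (≡.subst (_< suc n) (ℕ.+-suc (a ℕ.+ sumᵥ m) ∣ T ∣) m+T<n))))
  -- Both `0# ^ zero` and `1# ^ zero` compute to `1#`, so the two halves are the same expression and
  -- cancel.
  altSum-evalMonomial (outside ∷ T) (zero  ∷ m) m+T<n = -‿inverseʳ _
  altSum-evalMonomial (outside ∷ T) (suc a ∷ m) m+T<n = x≈y∧z≈0⇒x-z≈y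
    (altSum-*-zero T (0# ^ suc a) _ m≈0) (altSum-*-zero T (1# ^ suc a) _ m≈0)
    where
    m≈0 = altSum-evalMonomial T m
      (ℕ.≤-<-trans (ℕ.+-monoˡ-≤ ∣ T ∣ (ℕ.m≤n+m (sumᵥ m) a)) (s≤s⁻¹ m+T<n))

  module _ {n} (f : Polynomial F n) where
    open Polynomial f

    -- The disjunction lets each summand of `eval` be treated by cases, although vanishing of a
    -- coefficient need not be decidable.
    DegreeAtMost : ℕ → Set ℓ
    DegreeAtMost d = ∀ j → let m = lookupₗ support j in sumᵥ m ≤ d ⊎ coeff m ≈ 0#

    -- Equality in F need not be stable, so the high coefficients vanish only
    -- up to a double negation, which commutes with the finite quantifier.
    ¬¬degreeAtMost : ∀ {d} → HasTotalDegree F f d → ¬ ¬ DegreeAtMost d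
    ¬¬degreeAtMost (_ , bound) = sequence (RawMonad.rawApplicative ¬¬-Monad)
      λ j ¬p → ¬p (inj₁ (bound _ (¬p ∘ inj₂)))

    altSum-eval : ∀ {d} → DegreeAtMost d → (T : Subset n) → d ℕ.+ ∣ T ∣ < n →
                  altSum T (eval F f ∘ indicator) ≈ 0#
    altSum-eval {d} deg T d+T<n = altSum-sum T _ term≈0
      where
      term≈0 : ∀ j → let m = lookupₗ support j in
               altSum T (λ U → coeff m * evalMonomial F m (indicator U)) ≈ 0#
      term≈0 j with deg j
      ... | inj₁ m≤d = altSum-*-zero T _ _ (altSum-evalMonomial T (lookupₗ support j)
                         (ℕ.≤-<-trans (ℕ.+-monoˡ-≤ ∣ T ∣ m≤d) d+T<n))
      ... | inj₂ m≈0 = trans (altSum-* T _ _) (trans (*-congʳ m≈0) (zeroˡ _))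

    -- Downward induction on the weight of `T`, with `k` as fuel: a heavier set needs less of it,
    -- and none can be left with `k` zero because no weight exceeds `n`.
    eval-vanishes : ∀ {d r} → DegreeAtMost d → d ℕ.+ r < n →
                    (∀ U → r < ∣ U ∣ → eval F f (indicator U) ≈ 0#) →
                    ∀ k T → n < ∣ T ∣ ℕ.+ k → eval F f (indicator T) ≈ 0#
    eval-vanishes deg d+r<n f≈0 zero T n<T =
      contradiction (∣p∣≤n T) (ℕ.<⇒≱ (≡.subst (n <_) (ℕ.+-identityʳ _) n<T))
    eval-vanishes {d} {r} deg d+r<n f≈0 (suc k) T n<T+k with r ℕ.<? ∣ T ∣
    ... | yes r<T = f≈0 T r<T
    ... | no  r≮T = trans
      (sym (altSum-lowest T _ λ U T<U → eval-vanishes deg d+r<n f≈0 k U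
        (ℕ.<-≤-trans (≡.subst (n <_) (ℕ.+-suc ∣ T ∣ k) n<T+k)
                     (ℕ.+-monoˡ-≤ k T<U))))
      (altSum-eval deg T (ℕ.≤-<-trans (ℕ.+-monoʳ-≤ d (ℕ.≮⇒≥ r≮T)) d+r<n))

theorem1 : ∀ {c ℓ} (F : Field c ℓ) (n r : ℕ) → n ≥ 1 →
    ∀ (f : Polynomial F n) (d : ℕ) → HasTotalDegree F f d →
    (∀ (x : Vector (Field.Carrier F) n) (w : ℕ) →
    IsVertex F x → HasWeight F x w → r < w →
    Field._≈_ F (eval F f x) (Field.0# F)) →
    (∀ (x : Vector (Field.Carrier F) n) (w : ℕ) →
    IsVertex F x → HasWeight F x w → w ≤ r →
    Field._≉_ F (eval F f x) (Field.0# F)) →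
    d ≥ n ∸ r
theorem1 F n r n≥1 f d deg f≈0 f≉0 with n ∸ r ℕ.≤? d
... | yes n∸r≤d = n∸r≤d
-- Deciding the inequality first leaves only an absurdity to derive, so the doubly negated degree
-- bound suffices.
... | no  n∸r≰d = contradiction
  (λ deg′ → f≉0 (indicator F ⊥) ∣ ⊥ {n} ∣
    (indicator-isVertex F ⊥) (indicator-hasWeight F ⊥)
    (≡.subst (_≤ r) (≡.sym (∣⊥∣≡0 n)) z≤n)
    (eval-vanishes F f deg′ d+r<n
      (λ U → f≈0 _ _ (indicator-isVertex F U) (indicator-hasWeight F U))
      -- Fuel `suc n` is enough for a set of any weight.
      (suc n) ⊥ (ℕ.m≤n+m (suc n) ∣ ⊥ {n} ∣)))
  (¬¬degreeAtMost F f deg)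
  where
  d+r<n : d ℕ.+ r < n
  d+r<n = ℕ.≰⇒> λ n≤d+r →
    n∸r≰d (ℕ.m≤n+o⇒m∸n≤o n r (≡.subst (n ≤_) (ℕ.+-comm d r) n≤d+r))
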